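{- Let $\alpha>0$, and let the weighted multigraph $G'$ differ from the weighted multigraph $G$ in a $(k,t)$ edge only. Then for all $i=1,\ldots,n$ the following equations hold: $$\frac{\tau'_{i(kt)}}{d'_{kt}}=\frac{\tau_{i(kt)}}{d_{kt}},\quad\text{or, equivalently,}\quad \frac{d'_{ik}-d'_{it}}{d'_{kt}}=\frac{d_{ik}-d_{it}}{d_{kt}};$$ $$\frac{\pi'_{i(kt)}}{d'_{kt}}=\frac{\pi_{i(kt)}}{d_{kt}},\quad\text{or, equivalently,}\quad \frac{q'_{ik}-q'_{it}}{d'_{kt}}=\frac{q_{ik}-q_{it}}{d_{kt}}.$$
   Context: A weighted multigraph $G$ has finite vertex set $V(G)=\{1,\ldots,n\}$; multiple edges are allowed, loops are not, and all edge weights are strictly positive. Its Laplacian matrix $L=L(G)=(\ell_{ij})$ is given by: for $j\ne i$, $\ell_{ij}$ is minus the sum of the weights of all edges with terminal vertices $i$ and $j$; and $\ell_{ii}=-\sum_{j\neq i}\ell_{ij}$. For a fixed parameter $\alpha>0$, the relative forest accessibility matrix is $Q=(q_{ij})=(I+\alpha L)^{ -1}$, and the forest distance is $d_{ij}=\frac12(q_{ii}+q_{jj}-q_{ij}-q_{ji})$ (this is a metric on $V(G)$). For vertices $i,k,t$, put $\tau_{i(kt)}=d_{ik}-d_{it}$ and $\pi_{i(kt)}=q_{ik}-q_{it}$. For $k\neq t$, a weighted multigraph $G'$ (on the same vertex set) differs from $G$ in a $(k,t)$ edge only if, for some $\varepsilon\neq0$, $G'$ is obtained from $G$ by increasing the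 weight of some edge between $k$ and $t$ by $\varepsilon$, or by adding a new edge between $k$ and $t$ with weight $\varepsilon$ (when $\varepsilon>0$), or by removing an edge between $k$ and $t$ with weight $-\varepsilon$ (when $\varepsilon<0$). Unprimed quantities refer to $G$ and primed quantities refer to $G'$, with the same $\alpha$. -}

module Defs where

open import Level using (Level; _⊔_; suc)
open import Data.Nat.Base using (ℕ)
open import Data.Fin.Base using (Fin)
open import Data.Fin.Properties using (_≟_)
open import Data.List.Base using (List; []; _∷_; foldr; map; filter)
open import Data.Product.Base using (_×_; _,_; proj₁; ∃-syntax)
open import Data.Sum.Base using (_⊎_; inj₁; inj₂)
open import Data.Bool.Base using (if_then_else_)
open import Relation.Nullary.Decidable using (Dec; ⌊_⌋; _×-dec_; _⊎-dec_)
open import Relation.Binary.Core using (Rel; _Preserves_⟶_)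
open import Relation.Binary.Bundles using (Setoid)
open import Relation.Binary.Structures using (IsStrictPartialOrder)
open import Relation.Binary.PropositionalEquality.Core as ≡ using (_≡_; _≢_)
open import Algebra.Bundles using (CommutativeRing)
open import Algebra.Apartness.Bundles using (HeytingField)
import Algebra.Properties.CommutativeMonoid.Sum as Sum
import Algebra.Properties.Ring as RingProperties
import Algebra.Apartness.Properties.HeytingCommutativeRing as HeytingProperties
import Data.List.Relation.Binary.Permutation.Setoid as Permutation

-- Ordered fields with apartness as the meaning of "nonzero". Classically these
-- are exactly the ordered fields (take x # y to be ¬ x ≈ y); constructively
-- the Cauchy and the Dedekind reals are also of this kind, since < is not
-- required to be trichotomous.
record OrderedField (c ℓ₁ ℓ₂ ℓ₃ : Level) : Set (suc (c ⊔ ℓ₁ ⊔ ℓ₂ ⊔ ℓ₃)) where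
  infix 4 _<_
  field
    heytingField : HeytingField c ℓ₁ ℓ₂

  open HeytingField heytingField public

  field
    _<_                  : Rel Carrier ℓ₃
    isStrictPartialOrder : IsStrictPartialOrder _≈_ _<_
    <⇒#                  : ∀ {x y} → x < y → x # y
    #⇒<⊎>                : ∀ {x y} → x # y → x < y ⊎ y < x
    +-monoˡ-<            : ∀ z → (_+ z) Preserves _<_ ⟶ _<_
    *-pos                : ∀ {x y} → 0# < x → 0# < y → 0# < x * y

  open IsStrictPartialOrder isStrictPartialOrder public
    using (<-respʳ-≈; <-respˡ-≈)
    renaming (trans to <-trans; irrefl to <-irrefl)

  commutativeRing : CommutativeRing c ℓ₁
  commutativeRing = record { isCommutativeRing = isCommutativeRing }

  open CommutativeRing commutativeRing public
    using (ring; +-commutativeMonoid)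

  2# : Carrier
  2# = 1# + 1#

  private
    open RingProperties ring using (-‿distribˡ-*; -‿involutive)

    0<1 : 0# < 1#
    0<1 with #⇒<⊎> (HeytingProperties.1#0 heytingCommutativeRing)
    ... | inj₂ 0<1′ = 0<1′
    ... | inj₁ 1<0 = <-respʳ-≈ square (*-pos 0<-1 0<-1)
      where
      0<-1 : 0# < - 1#
      0<-1 = <-respʳ-≈ (+-identityˡ (- 1#))
               (<-respˡ-≈ (-‿inverseʳ 1#) (+-monoˡ-< (- 1#) 1<0))

      square : (- 1#) * (- 1#) ≈ 1#
      square = trans (sym (-‿distribˡ-* 1# (- 1#)))
                 (trans (-‿cong (*-identityˡ (- 1#))) (-‿involutive 1#))

  2#0 : 2# # 0#
  2#0 = #-sym (<⇒# (<-trans 0<1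
          (<-respˡ-≈ (+-identityˡ 1#) (+-monoˡ-< 1# 0<1))))

  -- #⇒invertible y#0 inverts y - 0#, which is ≈ y.
  infixl 7 _/_[_]
  _/_[_] : ∀ (x y : Carrier) → y # 0# → Carrier
  x / y [ y#0 ] = x * proj₁ (#⇒invertible y#0)

module ForestDistance {c ℓ₁ ℓ₂ ℓ₃ : Level} (F : OrderedField c ℓ₁ ℓ₂ ℓ₃) where

  open OrderedField F public
  open Sum +-commutativeMonoid using (sum)

  record Edge (n : ℕ) : Set (c ⊔ ℓ₃) where
    constructor edge
    field
      {src tgt} : Fin n
      no-loop   : src ≢ tgt
      weight    : Carrier
      positive  : 0# < weight
  open Edge public

  -- Edges are undirected: the order of src and tgt carries no information.
  Joins : ∀ {n} → Edge n → Fin n → Fin n → Set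
  Joins e i j = (src e ≡ i × tgt e ≡ j) ⊎ (src e ≡ j × tgt e ≡ i)

  joins? : ∀ {n} (i j : Fin n) (e : Edge n) → Dec (Joins e i j)
  joins? i j e = ((src e ≟ i) ×-dec (tgt e ≟ j)) ⊎-dec ((src e ≟ j) ×-dec (tgt e ≟ i))

  edgeSetoid : ℕ → Setoid (c ⊔ ℓ₃) ℓ₁
  edgeSetoid n = record
    { Carrier = Edge n
    ; _≈_ = _≈ᴱ_
    ; isEquivalence = record
      { refl  = inj₁ (≡.refl , ≡.refl) , refl
      ; sym   = λ {e} {f} (p , w) → flipped {e} {f} p , sym w
      ; trans = λ {e} {f} {g} (p , w) (q , v) → composed {e} {f} {g} p q , trans w v
      }
    }
    where
    _≈ᴱ_ : Rel (Edge n) ℓ₁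
    e ≈ᴱ f = Joins e (src f) (tgt f) × weight e ≈ weight f

    flipped : ∀ {e f : Edge n} → Joins e (src f) (tgt f) → Joins f (src e) (tgt e)
    flipped (inj₁ (p , q)) = inj₁ (≡.sym p , ≡.sym q)
    flipped (inj₂ (p , q)) = inj₂ (≡.sym q , ≡.sym p)

    composed : ∀ {e f g : Edge n} → Joins e (src f) (tgt f) →
               Joins f (src g) (tgt g) → Joins e (src g) (tgt g)
    composed (inj₁ (p , q)) (inj₁ (r , s)) = inj₁ (≡.trans p r , ≡.trans q s)
    composed (inj₁ (p , q)) (inj₂ (r , s)) = inj₂ (≡.trans p r , ≡.trans q s)
    composed (inj₂ (p , q)) (inj₁ (r , s)) = inj₂ (≡.trans p s , ≡.trans q r)
    composed (inj₂ (p , q)) (inj₂ (r , s)) = inj₁ (≡.trans p s , ≡.trans q r)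

  -- A weighted multigraph on the vertex set Fin n is its multiset of edges:
  -- a list, compared up to _↭_.
  Multigraph : ℕ → Set (c ⊔ ℓ₃)
  Multigraph n = List (Edge n)

  module _ {n : ℕ} where
    open Permutation (edgeSetoid n) public using (_↭_)

  module _ {n : ℕ} (k t : Fin n) (ε : Carrier) (G G′ : Multigraph n) where

    data DiffersBy : Set (c ⊔ ℓ₁ ⊔ ℓ₃) where
      reweighted : ∀ e e′ H → Joins e k t → Joins e′ k t →
                   weight e′ ≈ weight e + ε →
                   G ↭ e ∷ H → G′ ↭ e′ ∷ H → DiffersBy
      added      : ∀ e → Joins e k t → 0# < ε → weight e ≈ ε →
                   G′ ↭ e ∷ G → DiffersBy
      removed    : ∀ e → Joins e k t → ε < 0# → weight e ≈ - ε →
                   G ↭ e ∷ G′ → DiffersBy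

  DiffersInEdgeOnly : ∀ {n} → Fin n → Fin n → Multigraph n → Multigraph n →
                      Set (c ⊔ ℓ₁ ⊔ ℓ₂ ⊔ ℓ₃)
  DiffersInEdgeOnly k t G G′ = ∃[ ε ] (ε # 0# × DiffersBy k t ε G G′)

  Matrix : ℕ → Set c
  Matrix n = Fin n → Fin n → Carrier

  infix 4 _≈ᴹ_
  _≈ᴹ_ : ∀ {n} → Rel (Matrix n) ℓ₁
  A ≈ᴹ B = ∀ i j → A i j ≈ B i j

  identity : ∀ {n} → Matrix n
  identity i j = if ⌊ i ≟ j ⌋ then 1# else 0#

  infixl 6 _+ᴹ_
  _+ᴹ_ : ∀ {n} → Matrix n → Matrix n → Matrix n
  (A +ᴹ B) i j = A i j + B i j

  infixl 7 _·ᴹ_ _*ᴹ_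
  _·ᴹ_ : ∀ {n} → Carrier → Matrix n → Matrix n
  (a ·ᴹ A) i j = a * A i j

  _*ᴹ_ : ∀ {n} → Matrix n → Matrix n → Matrix n
  (A *ᴹ B) i j = sum λ m → A i m * B m j

  infix 4 _IsInverseOf_
  _IsInverseOf_ : ∀ {n} → Rel (Matrix n) ℓ₁
  B IsInverseOf A = A *ᴹ B ≈ᴹ identity × B *ᴹ A ≈ᴹ identity

  weightBetween : ∀ {n} → Multigraph n → Fin n → Fin n → Carrier
  weightBetween G i j = foldr _+_ 0# (map weight (filter (joins? i j) G))

  Laplacian : ∀ {n} → Multigraph n → Matrix n
  Laplacian G i j = if ⌊ i ≟ j ⌋
    then - (sum λ m → if ⌊ i ≟ m ⌋ then 0# else - weightBetween G i m)
    else - weightBetween G i j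

  -- Q = (I + αL(G))⁻¹, expressed as a relation; two-sided inverses are unique.
  IsForestAccessibility : ∀ {n} → Carrier → Multigraph n → Matrix n → Set ℓ₁
  IsForestAccessibility α G Q = Q IsInverseOf (identity +ᴹ α ·ᴹ Laplacian G)

  forestDistance : ∀ {n} → Matrix n → Matrix n
  forestDistance q i j = (q i i + q j j - q i j - q j i) / 2# [ 2#0 ]

  τ : ∀ {n} → Matrix n → (i k t : Fin n) → Carrier
  τ q i k t = forestDistance q i k - forestDistance q i t

  π : ∀ {n} → Matrix n → (i k t : Fin n) → Carrier
  π q i k t = q i k - q i t

{-# OPTIONS --safe #-}
module Submission where

-- Let M = I + αL and v = e_k - e_t. Changing a (k,t) edge by ε replaces M by
-- M′ = M + αε vvᵀ. The difference x = Qv of columns k and t of Q satisfies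
-- M x = v, hence M′ x = (1 + αε vᵀx) v and x = (1 + αε vᵀx) Q′v. So all column
-- differences scale by one common factor, and dually all row differences;
-- 2 d_kt = vᵀx and τ_i(kt) are linear in these, so the quotients do not change.
-- Moreover vᵀx = xᵀMx = |x|² + α Σ_e w_e (x_src - x_tgt)² is positive.

open import Defs
open import Algebra.Bundles using (CommutativeRing)
import Algebra.Apartness.Properties.HeytingCommutativeRing as HeytingProperties
import Algebra.Properties.AbelianGroup as AbelianGroupProperties
import Algebra.Properties.Ring as RingProperties
import Algebra.Properties.Semiring.Mult.TCOptimised as Multiples
import Algebra.Properties.Semiring.Sum as SemiringSum
import Algebra.Solver.Ring as RingSolver
open import Algebra.Solver.Ring.AlmostCommutativeRing
  using (fromCommutativeRing; _-Raw-AlmostCommutative⟶_)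
open import Data.Bool.Base using (if_then_else_)
open import Data.Fin.Base using (Fin; zero; suc)
open import Data.Fin.Properties using (_≟_)
open import Data.Integer.Base as ℤ using (ℤ; +_; -[1+_])
import Data.Integer.Properties as ℤ
open import Data.List.Base as List using ([]; _∷_; foldr)
open import Data.List.Properties using (filter-accept; filter-reject)
import Data.List.Relation.Binary.Permutation.Homogeneous as ↭
open import Data.List.Relation.Binary.Pointwise.Base using ([]; _∷_)
open import Data.Maybe.Base using (Maybe; map)
open import Data.Nat.Base as ℕ using (ℕ; zero; suc)
open import Data.Product.Base using (Σ-syntax; ∃-syntax; _×_; _,_; proj₁; proj₂)
import Data.Sign.Base as Sign
open import Data.Sum.Base using (inj₁; inj₂; _⊎_)
open import Function.Base using (_∘_)
open import Relation.Binary.PropositionalEquality.Core as ≡ using (_≡_; _≢_)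
import Relation.Binary.Reasoning.Setoid as SetoidReasoning
open import Relation.Nullary.Decidable using (Dec; ⌊_⌋; yes; no; dec⇒maybe)
open import Relation.Nullary.Negation using (¬_; contradiction)

-- The order is not assumed decidable, so positivity of the denominators has to be traced to an
-- explicit coordinate apart from zero; this is done for each graph separately. Scaling is stated as
-- unprimed = `γ` times primed, so that `γ` cancels by multiplication and is never inverted. The
-- Laplacian filters a list of edges and has different formulas on and off the diagonal, so its
-- rank-one behaviour is derived by adding edges one at a time. Row differences accompany column
-- differences because `τ` also contains q_ki - q_ti; they come from the same argument applied to
-- transposes.

-- The coefficients are integers so that cancelling terms can be recognised
-- although equality in the ring itself is not decidable.
module IntegerCoefficientSolver {c ℓ} (R : CommutativeRing c ℓ) where

  open CommutativeRing R
  open RingProperties ring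
    using (-0#≈0#; -‿involutive; -‿distribˡ-*; -‿distribʳ-*)
  open AbelianGroupProperties +-abelianGroup using (⁻¹-∙-comm; xyx⁻¹≈y)
  open Multiples semiring using (1+×; ×-homo-+; ×1-homo-*)
    renaming (_×_ to _·_)
  open SetoidReasoning setoid

  -- The optimised multiple makes `con (+ 1)` and `con (+ 2)` reduce to `1#` and `1# + 1#`, so
  -- solver equations match goals that mention `1#` or `2#`.
  fromℤ : ℤ → Carrier
  fromℤ (+ n)    = n · 1#
  fromℤ -[1+ n ] = - (suc n · 1#)

  fromℤ-neg : ∀ n → fromℤ (ℤ.- (+ n)) ≈ - (n · 1#)
  fromℤ-neg zero    = sym -0#≈0#
  fromℤ-neg (suc n) = refl

  fromℤ-⊖ : ∀ m n → fromℤ (m ℤ.⊖ n) ≈ m · 1# - n · 1#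
  fromℤ-⊖ m       zero    = sym (trans (+-congˡ -0#≈0#) (+-identityʳ _))
  fromℤ-⊖ zero    (suc n) = sym (+-identityˡ _)
  fromℤ-⊖ (suc m) (suc n) = begin
    fromℤ (suc m ℤ.⊖ suc n)       ≡⟨ ≡.cong fromℤ (ℤ.[1+m]⊖[1+n]≡m⊖n m n) ⟩
    fromℤ (m ℤ.⊖ n)               ≈⟨ fromℤ-⊖ m n ⟩
    a - b                         ≈⟨ +-congʳ (xyx⁻¹≈y 1# a) ⟨
    (1# + a - 1#) - b             ≈⟨ +-assoc _ _ _ ⟩
    (1# + a) + (- 1# - b)         ≈⟨ +-congˡ (⁻¹-∙-comm 1# b) ⟩
    (1# + a) - (1# + b)           ≈⟨ +-cong (1+× m 1#) (-‿cong (1+× n 1#)) ⟨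
    suc m · 1# - suc n · 1#       ∎
    where
    a = m · 1#
    b = n · 1#

  fromℤ-+ : ∀ i j → fromℤ (i ℤ.+ j) ≈ fromℤ i + fromℤ j
  fromℤ-+ (+ m)    (+ n)    = ×-homo-+ 1# m n
  fromℤ-+ (+ m)    -[1+ n ] = fromℤ-⊖ m (suc n)
  fromℤ-+ -[1+ m ] (+ n)    = trans (fromℤ-⊖ n (suc m)) (+-comm _ _)
  fromℤ-+ -[1+ m ] -[1+ n ] = begin
    - (suc (suc m ℕ.+ n) · 1#)       ≈⟨ -‿cong (1+× (suc m ℕ.+ n) 1#) ⟩
    - (1# + (suc m ℕ.+ n) · 1#)      ≈⟨ -‿cong (+-congˡ (×-homo-+ 1# (suc m) n)) ⟩
    - (1# + (suc m · 1# + n · 1#))   ≈⟨ -‿cong (+-assoc _ _ _) ⟨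
    - (1# + suc m · 1# + n · 1#)     ≈⟨ -‿cong (+-congʳ (+-comm _ _)) ⟩
    - (suc m · 1# + 1# + n · 1#)     ≈⟨ -‿cong (+-assoc _ _ _) ⟩
    - (suc m · 1# + (1# + n · 1#))   ≈⟨ -‿cong (+-congˡ (1+× n 1#)) ⟨
    - (suc m · 1# + suc n · 1#)      ≈⟨ ⁻¹-∙-comm _ _ ⟨
    - (suc m · 1#) - suc n · 1#      ∎

  fromℤ-◃⁺ : ∀ n → fromℤ (Sign.+ ℤ.◃ n) ≈ n · 1#
  fromℤ-◃⁺ zero    = refl
  fromℤ-◃⁺ (suc n) = refl

  fromℤ-◃⁻ : ∀ n → fromℤ (Sign.- ℤ.◃ n) ≈ - (n · 1#)
  fromℤ-◃⁻ zero    = sym -0#≈0#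
  fromℤ-◃⁻ (suc n) = refl

  fromℤ-* : ∀ i j → fromℤ (i ℤ.* j) ≈ fromℤ i * fromℤ j
  fromℤ-* (+ m)    (+ n)    = trans (fromℤ-◃⁺ (m ℕ.* n)) (×1-homo-* m n)
  fromℤ-* (+ m)    -[1+ n ] = begin
    fromℤ (Sign.- ℤ.◃ m ℕ.* suc n)   ≈⟨ fromℤ-◃⁻ (m ℕ.* suc n) ⟩
    - ((m ℕ.* suc n) · 1#)           ≈⟨ -‿cong (×1-homo-* m (suc n)) ⟩
    - (m · 1# * suc n · 1#)          ≈⟨ -‿distribʳ-* _ _ ⟩
    m · 1# * - (suc n · 1#)          ∎
  fromℤ-* -[1+ m ] (+ n)    = begin
    fromℤ (Sign.- ℤ.◃ suc m ℕ.* n)   ≈⟨ fromℤ-◃⁻ (suc m ℕ.* n) ⟩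
    - ((suc m ℕ.* n) · 1#)           ≈⟨ -‿cong (×1-homo-* (suc m) n) ⟩
    - (suc m · 1# * n · 1#)          ≈⟨ -‿distribˡ-* _ _ ⟩
    - (suc m · 1#) * n · 1#          ∎
  fromℤ-* -[1+ m ] -[1+ n ] = begin
    (suc m ℕ.* suc n) · 1#           ≈⟨ ×1-homo-* (suc m) (suc n) ⟩
    suc m · 1# * suc n · 1#          ≈⟨ -‿involutive _ ⟨
    - - (suc m · 1# * suc n · 1#)    ≈⟨ -‿cong (-‿distribʳ-* _ _) ⟩
    - (suc m · 1# * - (suc n · 1#))  ≈⟨ -‿distribˡ-* _ _ ⟩
    - (suc m · 1#) * - (suc n · 1#)  ∎

  fromℤ-- : ∀ i → fromℤ (ℤ.- i) ≈ - fromℤ i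
  fromℤ-- (+ n)    = fromℤ-neg n
  fromℤ-- -[1+ n ] = sym (-‿involutive _)

  fromℤ-morphism : ℤ.+-*-rawRing -Raw-AlmostCommutative⟶ fromCommutativeRing R
  fromℤ-morphism = record
    { ⟦_⟧    = fromℤ
    ; +-homo = fromℤ-+
    ; *-homo = fromℤ-*
    ; -‿homo = fromℤ--
    ; 0-homo = refl
    ; 1-homo = refl
    }

  fromℤ-≟ : ∀ i j → Maybe (fromℤ i ≈ fromℤ j)
  fromℤ-≟ i j = map (reflexive ∘ ≡.cong fromℤ) (dec⇒maybe (i ℤ.≟ j))

  open RingSolver ℤ.+-*-rawRing (fromCommutativeRing R) fromℤ-morphism fromℤ-≟ public
    using (solve; _:=_; _:+_; _:*_; _:-_; :-_; con)

module ForestDistanceProperties {c ℓ₁ ℓ₂ ℓ₃} (F : OrderedField c ℓ₁ ℓ₂ ℓ₃) where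

  open ForestDistance F hiding (zero)
  open CommutativeRing commutativeRing using (semiring)
  open RingProperties ring using (-0#≈0#)
  open IntegerCoefficientSolver commutativeRing
  open HeytingProperties heytingCommutativeRing
    using (invertibleˡ⇒#; x-0≈x; 1#0; x#0y#0→xy#0; #-congʳ)
  open SemiringSum semiring
    using (sum; sum-cong-≋; ∑-distrib-+; ∑-comm; *-distribˡ-sum; *-distribʳ-sum; sum-replicate-zero)
  open SetoidReasoning setoid

  private variable
    n : ℕ
    x y z : Carrier

  -- Apartness and sign without trichotomy.

  x#y⇒x-y#0 : x # y → x - y # 0#
  x#y⇒x-y#0 x#y with z , zx≈1 , _ ← #⇒invertible x#y =
    invertibleˡ⇒# (z , trans (*-congˡ (x-0≈x _)) zx≈1)

  -- Cotransitivity with `y` placed between `x + y` and `0#`.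
  x+y#0⇒x#0⊎y#0 : x + y # 0# → x # 0# ⊎ y # 0#
  x+y#0⇒x#0⊎y#0 {x} {y} x+y#0 with #-cotrans x+y#0 y
  ... | inj₁ x+y#y = inj₁ (#-congʳ (solve 2 (λ x y → x :+ y :- y := x) refl x y) (x#y⇒x-y#0 x+y#y))
  ... | inj₂ y#0   = inj₂ y#0

  x*y#0⇒y#0 : ∀ x y → x * y # 0# → y # 0#
  x*y#0⇒y#0 x y xy#0 with z , zxy≈1 , _ ← #⇒invertible xy#0 =
    invertibleˡ⇒# (z * x , trans (solve 3 (λ x y z →
      z :* x :* (y :- con (+ 0)) := z :* (x :* y :- con (+ 0))) refl x y z) zxy≈1)

  -- Produces the explicit nonzero coordinate on which strict positivity of the quadratic form
  -- rests.
  sum#0⇒∃#0 : (f : Fin n → Carrier) → sum f # 0# → ∃[ i ] f i # 0#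
  sum#0⇒∃#0 {zero}  f 0#0 = contradiction 0#0 (#-irrefl refl)
  sum#0⇒∃#0 {suc n} f s#0 with x+y#0⇒x#0⊎y#0 s#0
  ... | inj₁ f₀#0 = zero , f₀#0
  ... | inj₂ s#0′ with i , fᵢ#0 ← sum#0⇒∃#0 (f ∘ suc) s#0′ = suc i , fᵢ#0

  -- The negative form is used because a disjunction of positive and zero could not be established
  -- constructively for sums and squares.
  NonNegative : Carrier → Set ℓ₃
  NonNegative x = ¬ x < 0#

  nonNegative-resp-≈ : x ≈ y → NonNegative x → NonNegative y
  nonNegative-resp-≈ x≈y x≮0 y<0 = x≮0 (<-respˡ-≈ (sym x≈y) y<0)

  nonNegative∧#0⇒positive : NonNegative x → x # 0# → 0# < x
  nonNegative∧#0⇒positive x≮0 x#0 with #⇒<⊎> x#0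
  ... | inj₁ x<0 = contradiction x<0 x≮0
  ... | inj₂ 0<x = 0<x

  positive⇒nonNegative : 0# < x → NonNegative x
  positive⇒nonNegative 0<x x<0 = <-irrefl refl (<-trans 0<x x<0)

  0<x⇒y<x+y : ∀ y → 0# < x → y < x + y
  0<x⇒y<x+y y 0<x = <-respˡ-≈ (+-identityˡ y) (+-monoˡ-< y 0<x)

  -- If the sum were negative, one summand would be apart from zero, hence positive; the other would
  -- then lie below the negative sum.
  +-nonNegative : NonNegative x → NonNegative y → NonNegative (x + y)
  +-nonNegative {x} {y} x≮0 y≮0 x+y<0 with x+y#0⇒x#0⊎y#0 (<⇒# x+y<0)
  ... | inj₁ x#0 = y≮0 (<-trans (0<x⇒y<x+y y (nonNegative∧#0⇒positive x≮0 x#0)) x+y<0)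
  ... | inj₂ y#0 = x≮0 (<-trans (<-respʳ-≈ (+-comm y x)
                     (0<x⇒y<x+y x (nonNegative∧#0⇒positive y≮0 y#0))) x+y<0)

  -- Cotransitivity compares `x + y` with both ends of `x # 0#`: either the sum is itself apart from
  -- zero, or it is apart from `x`, which makes `y` positive.
  +-positive-nonNegative : 0# < x → NonNegative y → 0# < x + y
  +-positive-nonNegative {x} {y} 0<x y≮0 with #-cotrans (#-sym (<⇒# 0<x)) (x + y)
  ... | inj₂ x+y#0 = nonNegative∧#0⇒positive (+-nonNegative (positive⇒nonNegative 0<x) y≮0) x+y#0
  ... | inj₁ x#x+y = <-trans 0<x (<-respʳ-≈ (+-comm y x) (0<x⇒y<x+y x (nonNegative∧#0⇒positive y≮0 y#0)))
    where
    y#0 : y # 0#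
    y#0 = #-congʳ (solve 2 (λ x y → x :+ y :- x := y) refl x y) (x#y⇒x-y#0 (#-sym x#x+y))

  *-positive-nonNegative : 0# < x → NonNegative y → NonNegative (x * y)
  *-positive-nonNegative {x} {y} 0<x y≮0 xy<0 =
    positive⇒nonNegative (*-pos 0<x (nonNegative∧#0⇒positive y≮0 (x*y#0⇒y#0 x y (<⇒# xy<0)))) xy<0

  x<0⇒0<-x : x < 0# → 0# < - x
  x<0⇒0<-x {x} x<0 =
    <-respˡ-≈ (-‿inverseʳ x) (<-respʳ-≈ (+-identityˡ (- x)) (+-monoˡ-< (- x) x<0))

  square-positive : x # 0# → 0# < x * x
  square-positive {x} x#0 with #⇒<⊎> x#0
  ... | inj₂ 0<x = *-pos 0<x 0<x
  ... | inj₁ x<0 = <-respʳ-≈ (solve 1 (λ x → :- x :* :- x := x :* x) refl x)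
                     (*-pos (x<0⇒0<-x x<0) (x<0⇒0<-x x<0))

  square-nonNegative : ∀ x → NonNegative (x * x)
  square-nonNegative x xx<0 =
    positive⇒nonNegative (square-positive (x*y#0⇒y#0 x x (<⇒# xx<0))) xx<0

  sum-nonNegative : (f : Fin n → Carrier) → (∀ i → NonNegative (f i)) → NonNegative (sum f)
  sum-nonNegative {zero}  f f≮0 = <-irrefl refl
  sum-nonNegative {suc n} f f≮0 = +-nonNegative (f≮0 zero) (sum-nonNegative (f ∘ suc) (f≮0 ∘ suc))

  sum-positive : (f : Fin n → Carrier) → (∀ i → NonNegative (f i)) →
                 ∀ i → 0# < f i → 0# < sum f
  sum-positive f f≮0 zero    0<fᵢ = +-positive-nonNegative 0<fᵢ (sum-nonNegative (f ∘ suc) (f≮0 ∘ suc))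
  sum-positive f f≮0 (suc i) 0<fᵢ = <-respʳ-≈ (+-comm _ _)
    (+-positive-nonNegative (sum-positive (f ∘ suc) (f≮0 ∘ suc) i 0<fᵢ) (f≮0 zero))

  -- Finite sums and the identity matrix.

  sum-cong : {f g : Fin n → Carrier} → (∀ i → f i ≈ g i) → sum f ≈ sum g
  sum-cong f≈g = sum-cong-≋ f≈g

  sum-zero : {f : Fin n → Carrier} → (∀ i → f i ≈ 0#) → sum f ≈ 0#
  sum-zero {n} f≈0 = trans (sum-cong f≈0) (sum-replicate-zero n)

  identity-diagonal : (i : Fin n) → identity i i ≈ 1#
  identity-diagonal i with i ≟ i
  ... | yes _  = refl
  ... | no i≢i = contradiction ≡.refl i≢i

  identity-off-diagonal : {i j : Fin n} → i ≢ j → identity i j ≈ 0#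
  identity-off-diagonal {i = i} {j} i≢j with i ≟ j
  ... | yes i≡j = contradiction i≡j i≢j
  ... | no _    = refl

  identity-symmetric : (i j : Fin n) → identity i j ≈ identity j i
  identity-symmetric i j with i ≟ j
  ... | yes ≡.refl = sym (identity-diagonal i)
  ... | no i≢j     = sym (identity-off-diagonal (i≢j ∘ ≡.sym))

  identity-suc : (i j : Fin n) → identity (suc i) (suc j) ≈ identity i j
  identity-suc i j with i ≟ j
  ... | yes _ = refl
  ... | no _  = refl

  sum-identity : (i : Fin n) (f : Fin n → Carrier) → sum (λ j → identity i j * f j) ≈ f i
  sum-identity zero    f = begin
    1# * f zero + sum (λ j → 0# * f (suc j)) ≈⟨ +-cong (*-identityˡ _) (sum-zero (λ j → zeroˡ (f (suc j)))) ⟩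
    f zero + 0#                              ≈⟨ +-identityʳ _ ⟩
    f zero                                   ∎
  sum-identity (suc i) f = begin
    0# * f zero + sum (λ j → identity (suc i) (suc j) * f (suc j))
      ≈⟨ +-cong (zeroˡ _) (sum-cong (λ j → *-congʳ (identity-suc i j))) ⟩
    0# + sum (λ j → identity i j * f (suc j))
      ≈⟨ +-identityˡ _ ⟩
    sum (λ j → identity i j * f (suc j))
      ≈⟨ sum-identity i (f ∘ suc) ⟩
    f (suc i) ∎

  -- Matrices acting on vectors.

  infixl 7 _·ⱽ_
  infixr 7 _*ⱽ_

  _·ⱽ_ : (x y : Fin n → Carrier) → Carrier
  x ·ⱽ y = sum λ i → x i * y i

  _*ⱽ_ : Matrix n → (Fin n → Carrier) → Fin n → Carrier
  (A *ⱽ x) i = A i ·ⱽ x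

  _ᵀ : Matrix n → Matrix n
  (A ᵀ) i j = A j i

  sum-*-linear : ∀ a b (f g : Fin n → Carrier) →
                 sum (λ i → a * f i + b * g i) ≈ a * sum f + b * sum g
  sum-*-linear a b f g = begin
    sum (λ i → a * f i + b * g i)             ≈⟨ ∑-distrib-+ (λ i → a * f i) (λ i → b * g i) ⟩
    sum (λ i → a * f i) + sum (λ i → b * g i) ≈⟨ +-cong (*-distribˡ-sum a f) (*-distribˡ-sum b g) ⟨
    a * sum f + b * sum g                     ∎

  sum-linear : ∀ b (f g : Fin n → Carrier) → sum (λ i → f i + b * g i) ≈ sum f + b * sum g
  sum-linear b f g = begin
    sum (λ i → f i + b * g i)       ≈⟨ ∑-distrib-+ f (λ i → b * g i) ⟩
    sum f + sum (λ i → b * g i)     ≈⟨ +-congˡ (*-distribˡ-sum b g) ⟨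
    sum f + b * sum g               ∎

  *ᴹ-*ⱽ-assoc : (A B : Matrix n) (x : Fin n → Carrier) →
                ∀ i → ((A *ᴹ B) *ⱽ x) i ≈ (A *ⱽ B *ⱽ x) i
  *ᴹ-*ⱽ-assoc {n} A B x i = begin
    sum (λ j → sum (λ l → A i l * B l j) * x j)
      ≈⟨ sum-cong {n} (λ j → *-distribʳ-sum (x j) (λ l → A i l * B l j)) ⟩
    sum (λ j → sum (λ l → A i l * B l j * x j))
      ≈⟨ ∑-comm (λ j l → A i l * B l j * x j) ⟩
    sum (λ l → sum (λ j → A i l * B l j * x j))
      ≈⟨ sum-cong {n} (λ l → sum-cong {n} (λ j → *-assoc (A i l) (B l j) (x j))) ⟩
    sum (λ l → sum (λ j → A i l * (B l j * x j)))
      ≈⟨ sum-cong {n} (λ l → *-distribˡ-sum (A i l) (λ j → B l j * x j)) ⟨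
    sum (λ l → A i l * sum (λ j → B l j * x j)) ∎

  -- Incidence vectors and rank-one updates.

  incidence : (k t : Fin n) → Fin n → Carrier
  incidence k t i = identity k i - identity t i

  incidence-·ⱽ : (k t : Fin n) (x : Fin n → Carrier) → incidence k t ·ⱽ x ≈ x k - x t
  incidence-·ⱽ k t x = begin
    sum (λ i → (identity k i - identity t i) * x i)
      ≈⟨ sum-cong (λ i → solve 3 (λ a b x → (a :- b) :* x := a :* x :+ (:- con (+ 1)) :* (b :* x))
                           refl (identity k i) (identity t i) (x i)) ⟩
    sum (λ i → identity k i * x i + - 1# * (identity t i * x i))
      ≈⟨ sum-linear (- 1#) (λ i → identity k i * x i) (λ i → identity t i * x i) ⟩
    identity k ·ⱽ x + - 1# * (identity t ·ⱽ x)
      ≈⟨ +-cong (sum-identity k x) (*-congˡ (sum-identity t x)) ⟩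
    x k + - 1# * x t
      ≈⟨ solve 2 (λ a b → a :+ (:- con (+ 1)) :* b := a :- b) refl (x k) (x t) ⟩
    x k - x t ∎

  sum-incidence : (k t : Fin n) → sum (incidence k t) ≈ 0#
  sum-incidence k t = begin
    sum (incidence k t)                 ≈⟨ sum-cong (λ i → *-identityʳ (incidence k t i)) ⟨
    incidence k t ·ⱽ (λ _ → 1#)         ≈⟨ incidence-·ⱽ k t (λ _ → 1#) ⟩
    1# - 1#                             ≈⟨ -‿inverseʳ 1# ⟩
    0#                                  ∎

  incidence-src : {k t : Fin n} → k ≢ t → incidence k t k ≈ 1#
  incidence-src {k = k} {t} k≢t = trans
    (+-cong (identity-diagonal k) (-‿cong (identity-off-diagonal (k≢t ∘ ≡.sym)))) (x-0≈x 1#)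

  incidence-tgt : {k t : Fin n} → k ≢ t → incidence k t t ≈ - 1#
  incidence-tgt {k = k} {t} k≢t = trans
    (+-cong (identity-off-diagonal k≢t) (-‿cong (identity-diagonal t))) (+-identityˡ _)

  incidence-elsewhere : {k t i : Fin n} → k ≢ i → t ≢ i → incidence k t i ≈ 0#
  incidence-elsewhere k≢i t≢i = trans
    (+-cong (identity-off-diagonal k≢i) (-‿cong (identity-off-diagonal t≢i))) (x-0≈x 0#)

  -- Serves in two roles: for a Laplacian gaining one edge, with `β` its weight, and for the passage
  -- from `G` to `G′`, with `β` equal to `ε` or `α * ε`.
  RankOneUpdate : Fin n → Fin n → Carrier → Matrix n → Matrix n → Set ℓ₁
  RankOneUpdate k t β A B = ∀ i j → B i j ≈ A i j + β * (incidence k t i * incidence k t j)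

  rankOneUpdate-*ⱽ : ∀ {k t : Fin n} {β A B} → RankOneUpdate k t β A B → ∀ x i →
                     (B *ⱽ x) i ≈ (A *ⱽ x) i + β * (x k - x t) * incidence k t i
  rankOneUpdate-*ⱽ {k = k} {t} {β} {A} {B} B≈A+βvv x i = begin
    sum (λ j → B i j * x j)
      ≈⟨ sum-cong (λ j → trans (*-congʳ (B≈A+βvv i j))
           (solve 5 (λ a β v w x → (a :+ β :* (v :* w)) :* x := a :* x :+ β :* v :* (w :* x))
             refl (A i j) β (v i) (v j) (x j))) ⟩
    sum (λ j → A i j * x j + β * v i * (v j * x j))
      ≈⟨ sum-linear (β * v i) (λ j → A i j * x j) (λ j → v j * x j) ⟩
    (A *ⱽ x) i + β * v i * (v ·ⱽ x)
      ≈⟨ +-congˡ (*-congˡ (incidence-·ⱽ k t x)) ⟩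
    (A *ⱽ x) i + β * v i * (x k - x t)
      ≈⟨ +-congˡ (solve 3 (λ β v d → β :* v :* d := β :* d :* v) refl β (v i) (x k - x t)) ⟩
    (A *ⱽ x) i + β * (x k - x t) * v i ∎
    where
    v = incidence k t

  -- Isolates the contribution of one edge as its weight times a square, so that semidefiniteness of
  -- the Laplacian follows by induction on the edges.
  rankOneUpdate-quadraticForm :
    ∀ {k t : Fin n} {β A B} → RankOneUpdate k t β A B → ∀ x →
    x ·ⱽ (B *ⱽ x) ≈ x ·ⱽ (A *ⱽ x) + β * ((x k - x t) * (x k - x t))
  rankOneUpdate-quadraticForm {k = k} {t} {β} {A} {B} B≈A+βvv x = begin
    sum (λ i → x i * (B *ⱽ x) i)
      ≈⟨ sum-cong (λ i → trans (*-congˡ (rankOneUpdate-*ⱽ {B = B} B≈A+βvv x i))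
           (solve 4 (λ x a b v → x :* (a :+ b :* v) := x :* a :+ b :* (v :* x))
             refl (x i) ((A *ⱽ x) i) (β * δ) (v i))) ⟩
    sum (λ i → x i * (A *ⱽ x) i + β * δ * (v i * x i))
      ≈⟨ sum-linear (β * δ) (λ i → x i * (A *ⱽ x) i) (λ i → v i * x i) ⟩
    x ·ⱽ (A *ⱽ x) + β * δ * (v ·ⱽ x)
      ≈⟨ +-congˡ (trans (*-congˡ (incidence-·ⱽ k t x)) (*-assoc β δ δ)) ⟩
    x ·ⱽ (A *ⱽ x) + β * (δ * δ) ∎
    where
    v = incidence k t
    δ = x k - x t

  -- The Laplacian assembled edge by edge.

  edgeIncidence : Edge n → Fin n → Carrier
  edgeIncidence e = incidence (src e) (tgt e)

  -- As `e` is not a loop, its incidence vector is 1 and -1 at its two ends. For distinct `i` and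
  -- `j` the product of entries is thus -1 if `e` joins them and 0 otherwise, which encodes the
  -- filter algebraically.
  weightBetween-∷ : ∀ (e : Edge n) G {i j} → i ≢ j →
                    weightBetween (e ∷ G) i j ≈
                    weightBetween G i j - weight e * (edgeIncidence e i * edgeIncidence e j)
  weightBetween-∷ e G {i} {j} i≢j = by-cases (joins? i j e)
    where
    v = edgeIncidence e
    w = weight e
    W = weightBetween G i j

    total : Multigraph _ → Carrier
    total H = foldr _+_ 0# (List.map weight H)

    joined : Joins e i j → v i * v j ≈ - 1#
    joined (inj₁ (≡.refl , ≡.refl)) =
      trans (*-cong (incidence-src (no-loop e)) (incidence-tgt (no-loop e))) (*-identityˡ _)
    joined (inj₂ (≡.refl , ≡.refl)) =
      trans (*-cong (incidence-tgt (no-loop e)) (incidence-src (no-loop e))) (*-identityʳ _)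

    not-joined : ¬ Joins e i j → Dec (src e ≡ i) → Dec (tgt e ≡ i) → v i * v j ≈ 0#
    not-joined ¬p (no s≢i)     (no t≢i)     =
      trans (*-congʳ (incidence-elsewhere s≢i t≢i)) (zeroˡ _)
    -- One end of `e` is `i`; the other cannot be `j`, so the entry at `j` vanishes.
    not-joined ¬p (yes ≡.refl) _            =
      trans (*-congˡ (incidence-elsewhere i≢j (λ t≡j → ¬p (inj₁ (≡.refl , t≡j))))) (zeroʳ _)
    not-joined ¬p (no _)       (yes ≡.refl) =
      trans (*-congˡ (incidence-elsewhere (λ s≡j → ¬p (inj₂ (s≡j , ≡.refl))) i≢j)) (zeroʳ _)

    by-cases : Dec (Joins e i j) → weightBetween (e ∷ G) i j ≈ W - w * (v i * v j)
    by-cases (yes p) = begin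
      weightBetween (e ∷ G) i j   ≡⟨ ≡.cong total (filter-accept (joins? i j) p) ⟩
      w + W                       ≈⟨ solve 2 (λ w W → w :+ W := W :- w :* (:- con (+ 1))) refl w W ⟩
      W - w * - 1#                ≈⟨ +-congˡ (-‿cong (*-congˡ (joined p))) ⟨
      W - w * (v i * v j)         ∎
    by-cases (no ¬p) = begin
      weightBetween (e ∷ G) i j   ≡⟨ ≡.cong total (filter-reject (joins? i j) ¬p) ⟩
      W                           ≈⟨ solve 2 (λ w W → W := W :- w :* con (+ 0)) refl w W ⟩
      W - w * 0#                  ≈⟨ +-congˡ (-‿cong (*-congˡ (not-joined ¬p (src e ≟ i) (tgt e ≟ i)))) ⟨
      W - w * (v i * v j)         ∎

  -- Names the summand inside the diagonal case of `Laplacian`, so that its row sums can be followed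
  -- as edges are added.
  offDiagonal : Multigraph n → Matrix n
  offDiagonal G i j = if ⌊ i ≟ j ⌋ then 0# else - weightBetween G i j

  -- The diagonal must stay zero although the rank-one term does not vanish there; the multiple of
  -- `identity i j` cancels it.
  offDiagonal-∷ : ∀ (e : Edge n) G i j → let v = edgeIncidence e in
                  offDiagonal (e ∷ G) i j ≈
                  offDiagonal G i j +
                  (weight e * v i * v j + - (weight e * v i * v i) * identity i j)
  offDiagonal-∷ e G i j with i ≟ j
  ... | yes ≡.refl = solve 2 (λ w v → con (+ 0) :=
                       con (+ 0) :+ (w :* v :* v :+ :- (w :* v :* v) :* con (+ 1)))
                       refl (weight e) (edgeIncidence e i)
  ... | no i≢j     = trans (-‿cong (weightBetween-∷ e G i≢j))
                       (solve 4 (λ W w v u → :- (W :- w :* (v :* u)) :=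
                          :- W :+ (w :* v :* u :+ :- (w :* v :* v) :* con (+ 0)))
                          refl (weightBetween G i j) (weight e) (edgeIncidence e i) (edgeIncidence e j))

  sum-identity-row : (i : Fin n) → sum (identity i) ≈ 1#
  sum-identity-row i = trans (sum-cong (λ j → sym (*-identityʳ (identity i j)))) (sum-identity i (λ _ → 1#))

  -- The entries of `v` sum to zero, so only the diagonal correction survives summation over the
  -- row.
  sum-offDiagonal-∷ : ∀ (e : Edge n) G i → let v = edgeIncidence e in
                      sum (offDiagonal (e ∷ G) i) ≈
                      sum (offDiagonal G i) - weight e * (v i * v i)
  sum-offDiagonal-∷ e G i = begin
    sum (offDiagonal (e ∷ G) i)
      ≈⟨ sum-cong (offDiagonal-∷ e G i) ⟩
    sum (λ j → offDiagonal G i j + (w * v i * v j + - (w * v i * v i) * identity i j))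
      ≈⟨ ∑-distrib-+ (offDiagonal G i) (λ j → w * v i * v j + - (w * v i * v i) * identity i j) ⟩
    S + sum (λ j → w * v i * v j + - (w * v i * v i) * identity i j)
      ≈⟨ +-congˡ (sum-*-linear (w * v i) _ v (identity i)) ⟩
    S + (w * v i * sum v + - (w * v i * v i) * sum (identity i))
      ≈⟨ +-congˡ (+-cong (*-congˡ (sum-incidence (src e) (tgt e))) (*-congˡ (sum-identity-row i))) ⟩
    S + (w * v i * 0# + - (w * v i * v i) * 1#)
      ≈⟨ solve 3 (λ S w v → S :+ (w :* v :* con (+ 0) :+ :- (w :* v :* v) :* con (+ 1)) :=
           S :- w :* (v :* v)) refl S w (v i) ⟩
    S - w * (v i * v i) ∎
    where
    v = edgeIncidence e
    w = weight e
    S = sum (offDiagonal G i)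

  -- Both formulas for the entries obey the same update. Together with `Laplacian-[]` this makes the
  -- Laplacian the sum of w_e v_e v_eᵀ over the edges.
  Laplacian-∷ : ∀ (e : Edge n) G →
                RankOneUpdate (src e) (tgt e) (weight e) (Laplacian G) (Laplacian (e ∷ G))
  Laplacian-∷ e G i j with i ≟ j
  ... | yes ≡.refl = trans (-‿cong (sum-offDiagonal-∷ e G i))
                       (solve 2 (λ S x → :- (S :- x) := :- S :+ x) refl
                         (sum (offDiagonal G i)) (weight e * (edgeIncidence e i * edgeIncidence e i)))
  ... | no i≢j     = trans (-‿cong (weightBetween-∷ e G i≢j))
                       (solve 2 (λ S x → :- (S :- x) := :- S :+ x) refl
                         (weightBetween G i j) (weight e * (edgeIncidence e i * edgeIncidence e j)))

  offDiagonal-[] : (i j : Fin n) → offDiagonal [] i j ≈ 0#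
  offDiagonal-[] i j with i ≟ j
  ... | yes _ = refl
  ... | no _  = -0#≈0#

  Laplacian-[] : (i j : Fin n) → Laplacian [] i j ≈ 0#
  Laplacian-[] i j with i ≟ j
  ... | yes ≡.refl = trans (-‿cong (sum-zero (offDiagonal-[] i))) -0#≈0#
  ... | no _       = -0#≈0#

  Laplacian-positiveSemidefinite : ∀ G (x : Fin n → Carrier) → NonNegative (x ·ⱽ (Laplacian G *ⱽ x))
  Laplacian-positiveSemidefinite [] x =
    nonNegative-resp-≈ (sym (sum-zero λ i → trans
      (*-congˡ (sum-zero λ j → trans (*-congʳ (Laplacian-[] i j)) (zeroˡ (x j)))) (zeroʳ (x i))))
      (<-irrefl refl)
  Laplacian-positiveSemidefinite (e ∷ G) x =
    nonNegative-resp-≈ (sym (rankOneUpdate-quadraticForm {B = Laplacian (e ∷ G)} (Laplacian-∷ e G) x))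
      (+-nonNegative (Laplacian-positiveSemidefinite G x)
        (*-positive-nonNegative (positive e) (square-nonNegative (x (src e) - x (tgt e)))))

  -- Independence of edge order and orientation; the effect of an edge change.

  Laplacian-∷-joining : ∀ {k t} (e : Edge n) G → Joins e k t →
                        RankOneUpdate k t (weight e) (Laplacian G) (Laplacian (e ∷ G))
  Laplacian-∷-joining e G (inj₁ (≡.refl , ≡.refl)) i j = Laplacian-∷ e G i j
  -- Reversing the edge changes the sign of both factors, so their product is unchanged.
  Laplacian-∷-joining e G (inj₂ (≡.refl , ≡.refl)) i j = trans (Laplacian-∷ e G i j)
    (+-congˡ (*-congˡ (solve 4 (λ a b c d → (a :- b) :* (c :- d) := (b :- a) :* (d :- c)) refl
      (identity (src e) i) (identity (tgt e) i) (identity (src e) j) (identity (tgt e) j))))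

  Laplacian-cong-∷ : ∀ {e f : Edge n} {G H} → Joins e (src f) (tgt f) → weight e ≈ weight f →
                     Laplacian G ≈ᴹ Laplacian H → Laplacian (e ∷ G) ≈ᴹ Laplacian (f ∷ H)
  Laplacian-cong-∷ {e = e} {f} {G} {H} joins w≈ G≈H i j = begin
    Laplacian (e ∷ G) i j                    ≈⟨ Laplacian-∷-joining e G joins i j ⟩
    Laplacian G i j + weight e * (v i * v j) ≈⟨ +-cong (G≈H i j) (*-congʳ w≈) ⟩
    Laplacian H i j + weight f * (v i * v j) ≈⟨ Laplacian-∷ f H i j ⟨
    Laplacian (f ∷ H) i j                    ∎
    where
    v = edgeIncidence f

  Laplacian-swap : ∀ (e f : Edge n) G → Laplacian (e ∷ f ∷ G) ≈ᴹ Laplacian (f ∷ e ∷ G)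
  Laplacian-swap e f G i j = begin
    Laplacian (e ∷ f ∷ G) i j        ≈⟨ Laplacian-∷ e (f ∷ G) i j ⟩
    Laplacian (f ∷ G) i j + we       ≈⟨ +-congʳ (Laplacian-∷ f G i j) ⟩
    Laplacian G i j + wf + we     ≈⟨ solve 3 (λ a y x → a :+ y :+ x := a :+ x :+ y) refl (Laplacian G i j) wf we ⟩
    Laplacian G i j + we + wf     ≈⟨ +-congʳ (Laplacian-∷ e G i j) ⟨
    Laplacian (e ∷ G) i j + wf       ≈⟨ Laplacian-∷ f (e ∷ G) i j ⟨
    Laplacian (f ∷ e ∷ G) i j        ∎
    where
    we = weight e * (edgeIncidence e i * edgeIncidence e j)
    wf = weight f * (edgeIncidence f i * edgeIncidence f j)

  Laplacian-↭ : {G H : Multigraph n} → G ↭ H → Laplacian G ≈ᴹ Laplacian H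
  Laplacian-↭ (↭.refl [])                  i j = refl
  -- `↭.refl` relates pointwise equivalent lists, not identical ones, so edges may be reoriented
  -- here too and the case recurses.
  Laplacian-↭ (↭.refl ((e , w) ∷ eqs))         = Laplacian-cong-∷ e w (Laplacian-↭ (↭.refl eqs))
  Laplacian-↭ (↭.prep (e , w) G↭H)             = Laplacian-cong-∷ e w (Laplacian-↭ G↭H)
  Laplacian-↭ (↭.swap {ys = H} {x′ = e′} {f′} (e , w) (f , u) G↭H) i j = trans
    (Laplacian-cong-∷ e w (Laplacian-cong-∷ f u (Laplacian-↭ G↭H)) i j)
    (Laplacian-swap e′ f′ H i j)
  Laplacian-↭ (↭.trans G↭H H↭K)            i j = trans (Laplacian-↭ G↭H i j) (Laplacian-↭ H↭K i j)

  -- The three kinds of change collapse to one update: a reweighting compares two extensions of the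
  -- common remainder `H`, an addition is a single new edge, and a removal is an addition read
  -- backwards.
  Laplacian-differsBy : ∀ {k t : Fin n} {ε G G′} → DiffersBy k t ε G G′ →
                        RankOneUpdate k t ε (Laplacian G) (Laplacian G′)
  Laplacian-differsBy {k = k} {t} {ε} {G} {G′} (reweighted e e′ H e-joins e′-joins w′≈w+ε G↭ G′↭) i j = begin
    Laplacian G′ i j                    ≈⟨ Laplacian-↭ G′↭ i j ⟩
    Laplacian (e′ ∷ H) i j              ≈⟨ Laplacian-∷-joining e′ H e′-joins i j ⟩
    Laplacian H i j + weight e′ * vv    ≈⟨ +-congˡ (*-congʳ w′≈w+ε) ⟩
    Laplacian H i j + (weight e + ε) * vv
      ≈⟨ solve 4 (λ l w ε v → l :+ (w :+ ε) :* v := l :+ w :* v :+ ε :* v) refl (Laplacian H i j) (weight e) ε vv ⟩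
    Laplacian H i j + weight e * vv + ε * vv ≈⟨ +-congʳ (Laplacian-∷-joining e H e-joins i j) ⟨
    Laplacian (e ∷ H) i j + ε * vv      ≈⟨ +-congʳ (Laplacian-↭ G↭ i j) ⟨
    Laplacian G i j + ε * vv            ∎
    where
    vv = incidence k t i * incidence k t j
  Laplacian-differsBy {G = G} (added e joins _ w≈ε G′↭) i j =
    trans (Laplacian-↭ G′↭ i j) (trans (Laplacian-∷-joining e G joins i j) (+-congˡ (*-congʳ w≈ε)))
  Laplacian-differsBy {k = k} {t} {ε} {G} {G′} (removed e joins _ w≈-ε G↭) i j = begin
    -- Inserting and cancelling `ε * vv` exposes `G` as `G′` with an extra edge of weight `- ε`.
    Laplacian G′ i j                          ≈⟨ solve 3 (λ l ε v → l := l :+ :- ε :* v :+ ε :* v) refl (Laplacian G′ i j) ε vv ⟩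
    Laplacian G′ i j + - ε * vv + ε * vv      ≈⟨ +-congʳ (+-congˡ (*-congʳ w≈-ε)) ⟨
    Laplacian G′ i j + weight e * vv + ε * vv ≈⟨ +-congʳ (Laplacian-∷-joining e G′ joins i j) ⟨
    Laplacian (e ∷ G′) i j + ε * vv           ≈⟨ +-congʳ (Laplacian-↭ G↭ i j) ⟨
    Laplacian G i j + ε * vv                  ∎
    where
    vv = incidence k t i * incidence k t j

  -- The matrix I + αL and its quadratic form.

  regularised : Carrier → Multigraph n → Matrix n
  regularised α G = identity +ᴹ α ·ᴹ Laplacian G

  regularised-differsBy : ∀ α {k t : Fin n} {ε G G′} → DiffersBy k t ε G G′ →
                          RankOneUpdate k t (α * ε) (regularised α G) (regularised α G′)
  regularised-differsBy α {k} {t} {ε} {G} {G′} diff i j = trans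
    (+-congˡ (*-congˡ (Laplacian-differsBy diff i j)))
    (solve 5 (λ d α l ε v → d :+ α :* (l :+ ε :* v) := d :+ α :* l :+ α :* ε :* v) refl
      (identity i j) α (Laplacian G i j) ε (incidence k t i * incidence k t j))

  regularised-*ⱽ : ∀ α G (x : Fin n → Carrier) i →
                   (regularised α G *ⱽ x) i ≈ x i + α * (Laplacian G *ⱽ x) i
  regularised-*ⱽ α G x i = begin
    sum (λ j → (identity i j + α * Laplacian G i j) * x j)
      ≈⟨ sum-cong (λ j → solve 4 (λ d α l x → (d :+ α :* l) :* x := d :* x :+ α :* (l :* x)) refl
           (identity i j) α (Laplacian G i j) (x j)) ⟩
    sum (λ j → identity i j * x j + α * (Laplacian G i j * x j))
      ≈⟨ sum-linear α (λ j → identity i j * x j) (λ j → Laplacian G i j * x j) ⟩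
    identity i ·ⱽ x + α * (Laplacian G *ⱽ x) i
      ≈⟨ +-congʳ (sum-identity i x) ⟩
    x i + α * (Laplacian G *ⱽ x) i ∎

  -- The Laplacian part is only nonnegative; strictness comes from the square of the given
  -- coordinate `x i` inside |x|².
  regularised-positiveDefinite : ∀ {α} → 0# < α → ∀ G (x : Fin n → Carrier) i → x i # 0# →
                                 0# < x ·ⱽ (regularised α G *ⱽ x)
  regularised-positiveDefinite {α = α} 0<α G x i xᵢ#0 = <-respʳ-≈ (sym expand)
    (+-positive-nonNegative
      (sum-positive (λ j → x j * x j) (λ j → square-nonNegative (x j)) i (square-positive xᵢ#0))
      (*-positive-nonNegative 0<α (Laplacian-positiveSemidefinite G x)))
    where
    expand : x ·ⱽ (regularised α G *ⱽ x) ≈ x ·ⱽ x + α * (x ·ⱽ (Laplacian G *ⱽ x))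
    expand = begin
      sum (λ j → x j * (regularised α G *ⱽ x) j)
        ≈⟨ sum-cong (λ j → trans (*-congˡ (regularised-*ⱽ α G x j))
             (solve 3 (λ x α l → x :* (x :+ α :* l) := x :* x :+ α :* (x :* l)) refl
               (x j) α ((Laplacian G *ⱽ x) j))) ⟩
      sum (λ j → x j * x j + α * (x j * (Laplacian G *ⱽ x) j))
        ≈⟨ sum-linear α (λ j → x j * x j) (λ j → x j * (Laplacian G *ⱽ x) j) ⟩
      x ·ⱽ x + α * (x ·ⱽ (Laplacian G *ⱽ x)) ∎

  -- Column differences of the inverse and their scaling.

  *ⱽ-columnDifference : ∀ {A P : Matrix n} → A *ᴹ P ≈ᴹ identity → ∀ k t i →
                        (A *ⱽ (λ j → π P j k t)) i ≈ incidence k t i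
  *ⱽ-columnDifference {A = A} {P} AP≈I k t i = begin
    sum (λ j → A i j * (P j k - P j t))
      ≈⟨ sum-cong (λ j → solve 3 (λ a p q → a :* (p :- q) := a :* p :+ :- con (+ 1) :* (a :* q)) refl
           (A i j) (P j k) (P j t)) ⟩
    sum (λ j → A i j * P j k + - 1# * (A i j * P j t))
      ≈⟨ sum-linear (- 1#) (λ j → A i j * P j k) (λ j → A i j * P j t) ⟩
    (A *ᴹ P) i k + - 1# * (A *ᴹ P) i t
      ≈⟨ +-cong (trans (AP≈I i k) (identity-symmetric i k))
           (*-congˡ (trans (AP≈I i t) (identity-symmetric i t))) ⟩
    identity k i + - 1# * identity t i
      ≈⟨ solve 2 (λ a b → a :+ (:- con (+ 1)) :* b := a :- b) refl (identity k i) (identity t i) ⟩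
    incidence k t i ∎

  -- This is vᵀQv for v = `incidence k t`: twice the forest distance, kept free of division.
  πDifference : Matrix n → (k t : Fin n) → Carrier
  πDifference Q k t = π Q k k t - π Q t k t

  πDifference-positive : ∀ {α} → 0# < α → ∀ {G} {Q : Matrix n} → IsForestAccessibility α G Q →
                         ∀ {k t} → k ≢ t → 0# < πDifference Q k t
  πDifference-positive {α = α} 0<α {G} {Q} (MQ≈I , _) {k} {t} k≢t =
    <-respʳ-≈ qMq≈d (regularised-positiveDefinite 0<α G q (proj₁ nonzero) (proj₂ nonzero))
    where
    M = regularised α G
    q : Fin _ → Carrier
    q i = π Q i k t

    Mq≈v : ∀ i → (M *ⱽ q) i ≈ incidence k t i
    Mq≈v = *ⱽ-columnDifference {A = M} {P = Q} MQ≈I k t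

    -- Entry `k` of `M *ⱽ q` is 1, so some summand `M k j * q j` is apart from zero, and with it
    -- `q j`.
    nonzero : ∃[ i ] q i # 0#
    nonzero with j , Mq#0 ← sum#0⇒∃#0 (λ j → M k j * q j)
                   (#-congʳ (sym (trans (Mq≈v k) (incidence-src k≢t))) 1#0) =
      j , x*y#0⇒y#0 (M k j) (q j) Mq#0

    qMq≈d : q ·ⱽ (M *ⱽ q) ≈ q k - q t
    qMq≈d = begin
      sum (λ i → q i * (M *ⱽ q) i)       ≈⟨ sum-cong (λ i → trans (*-congˡ (Mq≈v i)) (*-comm _ _)) ⟩
      incidence k t ·ⱽ q                 ≈⟨ incidence-·ⱽ k t q ⟩
      q k - q t                          ∎

  -- A right inverse of `A` is paired with a left inverse of `B`; the transposed instance draws on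
  -- the opposite halves of the two inverse laws.
  π-rankOneUpdate : ∀ {k t : Fin n} {β A B P S} → RankOneUpdate k t β A B →
                    A *ᴹ P ≈ᴹ identity → S *ᴹ B ≈ᴹ identity →
                    ∀ i → π P i k t ≈ (1# + β * πDifference P k t) * π S i k t
  π-rankOneUpdate {k = k} {t} {β} {A} {B} {P} {S} B≈A+βvv AP≈I SB≈I i = begin
    q i                                ≈⟨ sum-identity i q ⟨
    identity i ·ⱽ q                    ≈⟨ sum-cong (λ j → *-congʳ (SB≈I i j)) ⟨
    ((S *ᴹ B) *ⱽ q) i                  ≈⟨ *ᴹ-*ⱽ-assoc S B q i ⟩
    sum (λ j → S i j * (B *ⱽ q) j)     ≈⟨ sum-cong (λ j → trans (*-congˡ (Bq≈γv j))
                                            (solve 3 (λ s γ v → s :* (γ :* v) := γ :* (v :* s)) refl (S i j) γ (v j))) ⟩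
    sum (λ j → γ * (v j * S i j))      ≈⟨ *-distribˡ-sum γ (λ j → v j * S i j) ⟨
    γ * (v ·ⱽ S i)                     ≈⟨ *-congˡ (incidence-·ⱽ k t (S i)) ⟩
    γ * π S i k t                      ∎
    where
    v = incidence k t
    q : Fin _ → Carrier
    q j = π P j k t
    γ = 1# + β * (q k - q t)

    Bq≈γv : ∀ j → (B *ⱽ q) j ≈ γ * v j
    Bq≈γv j = begin
      (B *ⱽ q) j                              ≈⟨ rankOneUpdate-*ⱽ {B = B} B≈A+βvv q j ⟩
      (A *ⱽ q) j + β * (q k - q t) * v j      ≈⟨ +-congʳ (*ⱽ-columnDifference {A = A} {P = P} AP≈I k t j) ⟩
      v j + β * (q k - q t) * v j             ≈⟨ solve 2 (λ v b → v :+ b :* v := (con (+ 1) :+ b) :* v) refl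
                                                   (v j) (β * (q k - q t)) ⟩
      γ * v j                                 ∎

  -- Transposition, carrying column differences to row differences.

  *ᴹ-ᵀ-inverse : {A B : Matrix n} → A *ᴹ B ≈ᴹ identity → B ᵀ *ᴹ A ᵀ ≈ᴹ identity
  *ᴹ-ᵀ-inverse {n} {A} {B} AB≈I i j = trans
    (sum-cong {n} (λ l → *-comm (B l i) (A j l))) (trans (AB≈I j i) (identity-symmetric j i))

  rankOneUpdate-ᵀ : ∀ {k t : Fin n} {β A B} → RankOneUpdate k t β A B → RankOneUpdate k t β (A ᵀ) (B ᵀ)
  rankOneUpdate-ᵀ B≈A+βvv i j = trans (B≈A+βvv j i) (+-congˡ (*-congˡ (*-comm _ _)))

  πDifference-ᵀ : ∀ (Q : Matrix n) k t → πDifference (Q ᵀ) k t ≈ πDifference Q k t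
  πDifference-ᵀ Q k t = solve 4 (λ a b c d → a :- b :- (c :- d) := a :- c :- (b :- d)) refl
    (Q k k) (Q t k) (Q k t) (Q t t)

  -- By definition the very factor by which `forestDistance` divides by `2#`.
  ½ : Carrier
  ½ = proj₁ (#⇒invertible 2#0)

  ½*2≈1 : ½ * 2# ≈ 1#
  ½*2≈1 = trans (*-congˡ (sym (x-0≈x 2#))) (proj₁ (proj₂ (#⇒invertible 2#0)))

  ½#0 : ½ # 0#
  ½#0 = x*y#0⇒y#0 2# ½ (#-congʳ (sym (trans (*-comm _ _) ½*2≈1)) 1#0)

  -- Forest distance and `τ` expressed through `π`.

  forestDistance≈½πDifference : ∀ (Q : Matrix n) k t → forestDistance Q k t ≈ πDifference Q k t * ½
  forestDistance≈½πDifference Q k t = *-congʳ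
    (solve 4 (λ a b c d → a :+ d :- b :- c := a :- b :- (c :- d)) refl
      (Q k k) (Q k t) (Q t k) (Q t t))

  -- q_kk - q_tt is half the sum of the row and column differences at k and t,
  -- so τ is a linear combination of such differences even without symmetry of Q.
  τ-by-π : ∀ (Q : Matrix n) i k t → let p = λ j → π Q j k t; r = λ j → π (Q ᵀ) j k t in
           τ Q i k t ≈ ½ * (½ * (p k + p t + r k + r t) - p i - r i)
  τ-by-π Q i k t = begin
    (Q i i + Q k k - Q i k - Q k i) * ½ - (Q i i + Q t t - Q i t - Q t i) * ½
      ≈⟨ solve 8 (λ h ii kk tt ik ki it ti →
           (ii :+ kk :- ik :- ki) :* h :- (ii :+ tt :- it :- ti) :* h :=
           h :* (con (+ 1) :* (kk :- tt) :- (ik :- it) :- (ki :- ti))) refl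
           ½ (Q i i) (Q k k) (Q t t) (Q i k) (Q k i) (Q i t) (Q t i) ⟩
    ½ * (1# * (Q k k - Q t t) - p i - r i)
      -- To the solver `½` is a free variable, so the factor `1#` kept for this purpose is exchanged
      -- for `½ * 2#`; the 2 is then spent on writing 2(q_kk - q_tt) as four differences.
      ≈⟨ *-congˡ (+-congʳ (+-congʳ (*-congʳ ½*2≈1))) ⟨
    ½ * (½ * 2# * (Q k k - Q t t) - p i - r i)
      ≈⟨ *-congˡ (+-congʳ (+-congʳ (solve 5 (λ h kk kt tk tt →
           h :* con (+ 2) :* (kk :- tt) :=
           h :* (kk :- kt :+ (tk :- tt) :+ (kk :- tk) :+ (kt :- tt))) refl
           ½ (Q k k) (Q k t) (Q t k) (Q t t)))) ⟩
    ½ * (½ * (p k + p t + r k + r t) - p i - r i) ∎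
    where
    p r : Fin _ → Carrier
    p j = π Q j k t
    r j = π (Q ᵀ) j k t

  -- Inserting `u * d` for `1#` and rewriting `d` as `γ * d′` supplies the `γ` that turns `a′` into
  -- `a`, while `d′` cancels against `u′`.
  /-scale-invariant : ∀ {γ a a′ d d′} (d#0 : d # 0#) (d′#0 : d′ # 0#) →
                      a ≈ γ * a′ → d ≈ γ * d′ → a′ / d′ [ d′#0 ] ≈ a / d [ d#0 ]
  /-scale-invariant {γ} {a} {a′} {d} {d′} d#0 d′#0 a≈γa′ d≈γd′
    with u , ud≈1 , _ ← #⇒invertible d#0 | u′ , u′d′≈1 , _ ← #⇒invertible d′#0 = begin
    a′ * u′                    ≈⟨ *-identityʳ _ ⟨
    a′ * u′ * 1#               ≈⟨ *-congˡ ud≈1 ⟨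
    a′ * u′ * (u * (d - 0#))   ≈⟨ *-congˡ (*-congˡ (+-congʳ d≈γd′)) ⟩
    a′ * u′ * (u * (γ * d′ - 0#))
      ≈⟨ solve 5 (λ a u u′ γ d → a :* u′ :* (u :* (γ :* d :- con (+ 0))) :=
           γ :* a :* (u′ :* (d :- con (+ 0))) :* u) refl a′ u u′ γ d′ ⟩
    γ * a′ * (u′ * (d′ - 0#)) * u ≈⟨ *-congʳ (*-cong (sym a≈γa′) u′d′≈1) ⟩
    a * 1# * u                 ≈⟨ *-congʳ (*-identityʳ a) ⟩
    a * u                      ∎

  -- The common factor and the invariance of the quotients.

  module Scaling {n} {γ} (Q Q′ : Matrix n) (k t : Fin n)
    (π-scales  : ∀ i → π Q i k t ≈ γ * π Q′ i k t)
    (πᵀ-scales : ∀ i → π (Q ᵀ) i k t ≈ γ * π (Q′ ᵀ) i k t)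
    where

    forestDistance-scales : forestDistance Q k t ≈ γ * forestDistance Q′ k t
    forestDistance-scales = begin
      forestDistance Q k t                              ≈⟨ forestDistance≈½πDifference Q k t ⟩
      (π Q k k t - π Q t k t) * ½                       ≈⟨ *-congʳ (+-cong (π-scales k) (-‿cong (π-scales t))) ⟩
      (γ * π Q′ k k t - γ * π Q′ t k t) * ½             ≈⟨ solve 4 (λ γ a b h → (γ :* a :- γ :* b) :* h := γ :* ((a :- b) :* h))
                                                             refl γ (π Q′ k k t) (π Q′ t k t) ½ ⟩
      γ * ((π Q′ k k t - π Q′ t k t) * ½)               ≈⟨ *-congˡ (forestDistance≈½πDifference Q′ k t) ⟨
      γ * forestDistance Q′ k t                         ∎

    τ-scales : ∀ i → τ Q i k t ≈ γ * τ Q′ i k t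
    τ-scales i = begin
      τ Q i k t
        ≈⟨ τ-by-π Q i k t ⟩
      ½ * (½ * (π Q k k t + π Q t k t + π (Q ᵀ) k k t + π (Q ᵀ) t k t) - π Q i k t - π (Q ᵀ) i k t)
        ≈⟨ *-congˡ (+-cong (+-cong (*-congˡ (+-cong (+-cong (+-cong
             (π-scales k) (π-scales t)) (πᵀ-scales k)) (πᵀ-scales t)))
             (-‿cong (π-scales i))) (-‿cong (πᵀ-scales i))) ⟩
      ½ * (½ * (γ * p k + γ * p t + γ * r k + γ * r t) - γ * p i - γ * r i)
        ≈⟨ solve 8 (λ h γ a b c d e f →
             h :* (h :* (γ :* a :+ γ :* b :+ γ :* c :+ γ :* d) :- γ :* e :- γ :* f) :=
             γ :* (h :* (h :* (a :+ b :+ c :+ d) :- e :- f))) refl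
             ½ γ (p k) (p t) (r k) (r t) (p i) (r i) ⟩
      γ * (½ * (½ * (p k + p t + r k + r t) - p i - r i))
        ≈⟨ *-congˡ (τ-by-π Q′ i k t) ⟨
      γ * τ Q′ i k t ∎
      where
      p r : Fin _ → Carrier
      p j = π Q′ j k t
      r j = π (Q′ ᵀ) j k t

  forestDistance#0 : ∀ {α} → 0# < α → ∀ {G} {Q : Matrix n} → IsForestAccessibility α G Q →
                     ∀ {k t} → k ≢ t → forestDistance Q k t # 0#
  forestDistance#0 0<α {G} {Q} Q-acc {k} {t} k≢t = #-congʳ (sym (forestDistance≈½πDifference Q k t))
    (x#0y#0→xy#0 (#-sym (<⇒# (πDifference-positive 0<α {G} {Q} Q-acc k≢t))) ½#0)

  quotients-agree : ∀ {α} → 0# < α → ∀ {G G′ : Multigraph n} {k t} → k ≢ t →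
    DiffersInEdgeOnly k t G G′ → ∀ {Q Q′} →
    IsForestAccessibility α G Q → IsForestAccessibility α G′ Q′ →
    Σ[ d#0 ∈ forestDistance Q k t # 0# ] Σ[ d′#0 ∈ forestDistance Q′ k t # 0# ] (∀ i →
      (τ Q′ i k t / forestDistance Q′ k t [ d′#0 ] ≈ τ Q i k t / forestDistance Q k t [ d#0 ]) ×
      (π Q′ i k t / forestDistance Q′ k t [ d′#0 ] ≈ π Q i k t / forestDistance Q k t [ d#0 ]))
  quotients-agree {α = α} 0<α {G} {G′} {k} {t} k≢t (ε , _ , diff) {Q} {Q′}
    Q-acc@(MQ≈I , QM≈I) Q′-acc@(M′Q′≈I , Q′M′≈I) =
    d#0 , d′#0 , λ i →
      /-scale-invariant d#0 d′#0 (τ-scales i) forestDistance-scales ,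
      /-scale-invariant d#0 d′#0 (π-scales i) forestDistance-scales
    where
    M  = regularised α G
    M′ = regularised α G′
    d#0  = forestDistance#0 0<α {G} {Q} Q-acc k≢t
    d′#0 = forestDistance#0 0<α {G′} {Q′} Q′-acc k≢t

    update : RankOneUpdate k t (α * ε) M M′
    update = regularised-differsBy α diff

    γ = 1# + α * ε * πDifference Q k t

    π-scales : ∀ i → π Q i k t ≈ γ * π Q′ i k t
    π-scales = π-rankOneUpdate {A = M} {M′} {Q} {Q′} update MQ≈I Q′M′≈I

    -- The transposed instance yields its own factor, built from `πDifference (Q ᵀ) k t`;
    -- `πDifference-ᵀ` identifies it with `γ`.
    πᵀ-scales : ∀ i → π (Q ᵀ) i k t ≈ γ * π (Q′ ᵀ) i k t
    πᵀ-scales i = trans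
      (π-rankOneUpdate {A = M ᵀ} {M′ ᵀ} {Q ᵀ} {Q′ ᵀ} (rankOneUpdate-ᵀ {A = M} {M′} update)
        (*ᴹ-ᵀ-inverse {A = Q} {M} QM≈I) (*ᴹ-ᵀ-inverse {A = M′} {Q′} M′Q′≈I) i)
      (*-congʳ (+-congˡ (*-congˡ (πDifference-ᵀ Q k t))))

    open Scaling Q Q′ k t π-scales πᵀ-scales

proposition9 : ∀ {c ℓ₁ ℓ₂ ℓ₃} (F : OrderedField c ℓ₁ ℓ₂ ℓ₃) →
    let open ForestDistance F in
    ∀ (n : ℕ) (α : Carrier) → 0# < α →
    ∀ (G G′ : Multigraph n) (k t : Fin n) → k ≢ t →
    DiffersInEdgeOnly k t G G′ →
    ∀ (Q Q′ : Matrix n) →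
    IsForestAccessibility α G Q → IsForestAccessibility α G′ Q′ →
    let d = forestDistance Q
        d′ = forestDistance Q′ in
    -- the two denominators are nonzero, so that the quotients are defined
    Σ[ d≠0 ∈ d k t # 0# ] Σ[ d′≠0 ∈ d′ k t # 0# ]
    (∀ (i : Fin n) →
      (τ Q′ i k t / d′ k t [ d′≠0 ] ≈ τ Q i k t / d k t [ d≠0 ]) ×
      (π Q′ i k t / d′ k t [ d′≠0 ] ≈ π Q i k t / d k t [ d≠0 ]))
proposition9 F n α 0<α G G′ k t k≢t differs Q Q′ Q-acc Q′-acc =
  quotients-agree 0<α k≢t differs Q-acc Q′-acc
  where open ForestDistanceProperties F
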